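{- Let $\mathcal X_1=(\Omega_1,S_1)$ and $\mathcal X_2=(\Omega_2,S_2)$ be coherent configurations, $\mathcal X=\mathcal X_1\wr\mathcal X_2$, and $b=\max\{gb(\mathcal X_1),gb(\mathcal X_2)\}$. Suppose that $\mathcal X_1$ is antisymmetric. Then $gb(\mathcal X)\le b$. Moreover, if $b>0$, then $\mathcal X$ has a proper generalized base of size $b$.
   Context: A coherent configuration on a finite set $\Omega$ is $\mathcal X=(\Omega,S)$ with $S$ a partition of $\Omega\times\Omega$ such that $1_\Omega$ is a union of elements of $S$, $s^*=\{(\beta,\alpha):(\alpha,\beta)\in s\}\in S$ for $s\in S$, and for $r,s,t\in S$ the number $|\{\gamma:(\alpha,\gamma)\in r,(\gamma,\beta)\in s\}|$ is independent of $(\alpha,\beta)\in t$. Relations are unions of elements of $S$; fibers are sets $\Gamma$ with $1_\Gamma\in S$. Antisymmetric: every $s\in S$ with $s=s^*$ lies in $1_\Omega$. A fission is a coherent configuration on the same set whose relations include all relations of $\mathcal X$; complete: all basic relations singletons. For $\Pi\subseteq2^\Omega$ the $\Pi$-fission is the smallest fission in which each member of $\Pi$ is a union of fibers; $\Pi$ is a generalized base if the $\Pi$-fission is complete; $gb(\mathcal X)$ is the minimal size of a generalized base. For an equivalence relation $e$ that is a relation of $\mathcal X$ and a class $\Delta$, $\mathcal X_\Delta=(\Delta,\{s\cap\Delta^2\}\setminus\{\emptyset\})$, and the quotient $\mathcal X_{\Omega/e}$ is the coherent configuration on $\Omega/e$ with basic relations $\{(\Gamma,\Delta):s\cap(\Gamma\times\Delta)\neq\emptyset\}$,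 $s\in S$. The wreath product $\mathcal X_1\wr\mathcal X_2$ is the smallest coherent configuration on $\Omega_1\times\Omega_2$ such that the equivalence relation $e$ with classes $\Omega_a=\Omega_1\times\{a\}$ ($a\in\Omega_2$) is a relation, each $\mathcal X_{\Omega_a}$ is the image of $\mathcal X_1$ under $x\mapsto(x,a)$, and $\mathcal X_{\Omega/e}$ is the image of $\mathcal X_2$ under $a\mapsto\Omega_a$. A generalized base $\Pi$ of $\mathcal X_1\wr\mathcal X_2$ is proper if there is $\Gamma\in\Pi$ such that $\Gamma\cap\Omega_a$ is a proper subset of $\Omega_a$ for all $a\in\Omega_2$.
   Formalization: The "Moreover" part assumes |Ω₁| > 1 (it fails for |Ω₁| = 1, e.g. with X₂ trivial on two points) and Ω₂ nonempty; the wreath product is any minimal, rather than least, configuration with the listed properties, since a least one need not exist. -}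

module Defs where

open import Data.Nat using (ℕ; _*_; _≤_)
open import Data.Fin using (Fin; combine; remQuot; _≟_)
open import Data.Fin.Subset using (Subset; _∈_; _∩_; _⊂_; ⋃)
open import Data.List using (List; length; filter; allFin)
open import Data.List.Relation.Unary.All using (All)
open import Data.List.Relation.Unary.Any using (Any)
open import Data.List.Relation.Unary.Unique.Propositional using (Unique)
open import Data.Vec using (tabulate)
open import Data.Product using (∃; ∃₂; _×_; proj₂)
open import Function using (flip)
open import Level using (0ℓ)
open import Relation.Binary.Core using (Rel; _⇒_; _⇔_)
open import Relation.Binary.PropositionalEquality using (_≡_)
open import Relation.Nullary.Decidable using (does; _×-dec_)
open import Relation.Unary using (Pred; _≐_)

private variable
  n n₁ n₂ r : ℕ

-- A partition of Ω × Ω, Ω = Fin n, is given by a colouring of the pairs: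
-- its elements are the colour classes.
Class : (Fin n → Fin n → Fin r) → Fin r → Rel (Fin n) 0ℓ
Class colour s α β = colour α β ≡ s

IsUnionOfClasses : (Fin n → Fin n → Fin r) → Rel (Fin n) 0ℓ → Set
IsUnionOfClasses {r = r} colour R =
  ∃ λ (I : Subset r) → R ⇔ (λ α β → colour α β ∈ I)

record CoherentConfiguration (n : ℕ) : Set where
  field
    rank   : ℕ
    colour : Fin n → Fin n → Fin rank

  -- The set S of basic relations is { basic s : s ∈ Fin rank }.
  basic : Fin rank → Rel (Fin n) 0ℓ
  basic = Class colour

  paths : Fin rank → Fin rank → Fin n → Fin n → ℕ
  paths s t α β =
    length (filter (λ γ → (colour α γ ≟ s) ×-dec (colour γ β ≟ t)) (allFin n))

  field
    nonempty : ∀ s → ∃₂ λ α β → basic s α β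
    diagonal : IsUnionOfClasses colour _≡_
    converse : ∀ s → ∃ λ s* → basic s* ⇔ flip (basic s)
    coherent : ∀ s t u {α β α′ β′} → basic u α β → basic u α′ β′ →
               paths s t α β ≡ paths s t α′ β′

open CoherentConfiguration public using (rank; colour; basic)

IsRelation : CoherentConfiguration n → Rel (Fin n) 0ℓ → Set
IsRelation X = IsUnionOfClasses (colour X)

IsFiber : CoherentConfiguration n → Subset n → Set
IsFiber X Γ = ∃ λ s → basic X s ⇔ (λ α β → α ≡ β × α ∈ Γ)

IsUnionOfFibers : CoherentConfiguration n → Subset n → Set
IsUnionOfFibers X Γ = ∃ λ Φs → All (IsFiber X) Φs × ⋃ Φs ≡ Γ

Antisymmetric : CoherentConfiguration n → Set
Antisymmetric X = ∀ s → basic X s ⇔ flip (basic X s) → basic X s ⇒ _≡_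

Complete : CoherentConfiguration n → Set
Complete X = ∀ s {α β α′ β′} → basic X s α β → basic X s α′ β′ → α ≡ α′ × β ≡ β′

-- "X ≤ Y": Y is a fission of X.
_≤ᶠ_ : CoherentConfiguration n → CoherentConfiguration n → Set₁
X ≤ᶠ Y = ∀ R → IsRelation X R → IsRelation Y R

infix 4 _≤ᶠ_

record IsSetFission (X : CoherentConfiguration n) (Π : List (Subset n))
                    (Y : CoherentConfiguration n) : Set₁ where
  field
    fission  : X ≤ᶠ Y
    unions   : All (IsUnionOfFibers Y) Π
    smallest : ∀ Z → X ≤ᶠ Z → All (IsUnionOfFibers Z) Π → Y ≤ᶠ Z

-- A set Π of subsets of Ω is a duplicate-free list, so that |Π| = length Π.
IsGeneralizedBase : CoherentConfiguration n → List (Subset n) → Set₁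
IsGeneralizedBase X Π = Unique Π × ∃ λ Y → IsSetFission X Π Y × Complete Y

-- gb(X) = k
IsGb : CoherentConfiguration n → ℕ → Set₁
IsGb X k = (∃ λ Π → IsGeneralizedBase X Π × length Π ≡ k)
         × (∀ Π → IsGeneralizedBase X Π → k ≤ length Π)

-- Sets of relations on A, compared with _≐_.
Family : Set → Set₁
Family A = Pred (Rel A 0ℓ) 0ℓ

-- The basic relations of X_Δ, regarded as relations on Ω contained in Δ × Δ.
restriction : CoherentConfiguration n → Subset n → Family (Fin n)
restriction X Δ R =
    (∃ λ s → R ⇔ (λ α β → basic X s α β × α ∈ Δ × β ∈ Δ))
  × (∃₂ λ α β → R α β)

IsClassOf : Rel (Fin n) 0ℓ → Subset n → Set
IsClassOf e Δ = ∃ λ α → ∀ β → (β ∈ Δ → e α β) × (e α β → β ∈ Δ)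

-- The basic relations of X_{Ω/e}; the points of Ω/e are the classes of e.
quotient : CoherentConfiguration n → Rel (Fin n) 0ℓ → Family (Subset n)
quotient X e R = ∃ λ s → R ⇔ λ Γ Δ →
  IsClassOf e Γ × IsClassOf e Δ × ∃₂ λ α β → α ∈ Γ × β ∈ Δ × basic X s α β

-- The images of the basic relations of X under f.
image : {A : Set} → (Fin n → A) → CoherentConfiguration n → Family A
image f X R = ∃ λ s → R ⇔ λ u v → ∃₂ λ α β → f α ≡ u × f β ≡ v × basic X s α β

-- Ω₁ × Ω₂ is Fin (n₁ * n₂), the pair (x , a) being  combine x a.
second : ∀ n₁ n₂ → Fin (n₁ * n₂) → Fin n₂
second n₁ n₂ α = proj₂ (remQuot {n₁} n₂ α)

SameBlock : ∀ n₁ n₂ → Rel (Fin (n₁ * n₂)) 0ℓ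
SameBlock n₁ n₂ α β = second n₁ n₂ α ≡ second n₁ n₂ β

block : ∀ n₁ n₂ → Fin n₂ → Subset (n₁ * n₂)
block n₁ n₂ a = tabulate λ α → does (second n₁ n₂ α ≟ a)

record WreathConditions (X₁ : CoherentConfiguration n₁) (X₂ : CoherentConfiguration n₂)
                        (X : CoherentConfiguration (n₁ * n₂)) : Set₁ where
  field
    isRelation   : IsRelation X (SameBlock n₁ n₂)
    restrictions : ∀ a → restriction X (block n₁ n₂ a) ≐ image (λ x → combine x a) X₁
    quotients    : quotient X (SameBlock n₁ n₂) ≐ image (block n₁ n₂) X₂

-- "Smallest" is minimality for ≤ᶠ: there need not be a least configuration
-- satisfying the conditions, since the identifications of the restrictions to
-- different blocks can be twisted by an algebraic automorphism of X₁ (for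
-- instance s ↦ s*, if X₁ is commutative).  The usual wreath product is minimal;
-- if there is a least configuration, it is the only minimal one up to recolouring.
record IsWreathProduct (X₁ : CoherentConfiguration n₁) (X₂ : CoherentConfiguration n₂)
                       (X : CoherentConfiguration (n₁ * n₂)) : Set₁ where
  field
    conditions : WreathConditions X₁ X₂ X
    minimal    : ∀ Y → WreathConditions X₁ X₂ Y → Y ≤ᶠ X → X ≤ᶠ Y

IsProper : ∀ n₁ n₂ → List (Subset (n₁ * n₂)) → Set
IsProper n₁ n₂ = Any λ Γ → ∀ a → Γ ∩ block n₁ n₂ a ⊂ block n₁ n₂ a

{-# OPTIONS --safe #-}

-- Let F be a fiber of X₁.  As X₁ is antisymmetric, comparing the colours of (x , y) and
-- (y , x) makes F a regular tournament, so |F| is odd.  For Γ ⊆ Ω₁ and Δ ⊆ Ω₂ let Λ(Γ , Δ)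
-- meet the block of a in Γ if a ∈ Δ, and in the symmetric difference Γ + F if a ∉ Δ.  If
-- Λ(Γ , Δ) is a union of fibers of a fission Z of X, then the parity of |Λ(Γ , Δ) ∩ Ω_a|
-- shows that Δ is a union of fibers of the quotient of Z, and Γ is one of the restriction of
-- Z to every block because F is.  Hence, pairing the members of bases of X₁ and X₂, the
-- quotient of Z is complete, so Z separates the blocks, and its restrictions are complete.
-- A member Γ equal to Ω₁ or Ω₁ \ F carries no information and is replaced by a point of F,
-- which makes all Λ(Γ , Δ) proper.
module Submission where

open import Defs
open import Data.Bool as Bool using (Bool; true; false; not; _∧_; _xor_; if_then_else_)
open import Data.Bool.Properties using (xor-identityʳ; ∧-zeroʳ; ∧-identityʳ; ¬-not)
open import Data.Fin using (Fin; zero; suc; combine; remQuot; punchIn; _≟_; _↑ˡ_; _↑ʳ_)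
open import Data.Fin.Properties using (any?; combine-injective; suc-injective; combine-remQuot; remQuot-combine; <-cmp; <-irrefl; _<?_; nonZeroIndex)
open import Data.Fin.Subset using (Subset; _∈_; ⋃; ⁅_⁆; ⊤; _∩_; _∉_)
open import Data.Fin.Subset.Properties using (x∈⁅x⁆; x∈⁅y⁆⇒x≡y; x∈p∪q⁺; x∈p∪q⁻; ∉⊥; ⊆-antisym; _∈?_; p∩q⊆p; p∩q⊆q)
open import Data.List using (List; []; _∷_; length; filter; map; tabulate; allFin; _++_; alignWith)
import Data.List.Membership.DecPropositional as DecMembership
import Data.List.Membership.Propositional as List
open import Data.List.Membership.Propositional.Properties using (∈-map⁺; ∈-map⁻; ∈-filter⁺; ∈-filter⁻; ∈-allFin; ∈-∃++; ∈-++⁺ˡ; ∈-++⁺ʳ; ∈-++⁻)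
open import Data.List.Properties using (length-++-sucʳ; length-alignWith; length-map)
open import Data.List.Relation.Unary.All as All using (All; []; _∷_)
open import Data.List.Relation.Unary.AllPairs using ([]; _∷_)
open import Data.List.Relation.Unary.Any as Any using (here; there)
open import Data.List.Relation.Unary.Unique.Propositional using (Unique)
open import Data.List.Relation.Unary.Unique.Propositional.Properties using (map⁺)
open import Data.Nat using (ℕ; zero; suc; _+_; _*_; _≤_; _<_; z≤n; s≤s; z<s; >-nonZero; _⊔_)
open import Data.Nat.Properties using (+-*-semiring; +-cancelˡ-≡; *-cancelˡ-≡; +-assoc; +-identityʳ; even≢odd; ≤-reflexive; ≤-trans; ⊔-sel; <⇒≱; n≤1+n)
open import Data.Product using (Σ; ∃; ∃₂; _×_; _,_; proj₁; proj₂; uncurry)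
open import Data.Product.Properties using (,-injective) renaming (≡-dec to ×-≡-dec)
open import Data.Sum using (inj₁; inj₂)
open import Data.These using (foldWithDefaults)
open import Data.Vec using (lookup) renaming (tabulate to tabulateᵛ)
open import Data.Vec.Functional using (removeAt)
open import Data.Vec.Properties using (lookup∘tabulate; []=⇒lookup; lookup⇒[]=; tabulate∘lookup; tabulate-cong) renaming (≡-dec to Vec-≡-dec)
open import Function using (_∘_; id; mk⇔)
open import Relation.Binary.Definitions using (DecidableEquality; tri<; tri≈; tri>)
open import Relation.Binary.PropositionalEquality using (_≡_; _≢_; refl; sym; trans; cong; cong₂; subst; module ≡-Reasoning)
open import Relation.Nullary using (Dec; yes; no; does; ¬_; contradiction)
open import Relation.Nullary.Decidable using (dec-true; dec-false; does-⇔; _×-dec_; ¬?; decidable-stable)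
open import Algebra.Properties.Semiring.Sum +-*-semiring using (sum; sum-cong-≗; sum-remove; sum-replicate-zero; sum-syntax; ∑-comm; ∑-distrib-+; *-distribˡ-sum; *-distribʳ-sum)

private variable
  m n n₁ n₂ : ℕ
  A B C : Set

from-does : {P : Set} (P? : Dec P) → does P? ≡ true → P
from-does (yes p) _ = p

-- Counting

⟦_⟧ : Bool → ℕ
⟦ b ⟧ = if b then 1 else 0

count : (Fin n → Bool) → ℕ
count P = sum (⟦_⟧ ∘ P)

-- Turns the lengths in `paths` into sums. The list is a general `tabulate f` so that the induction
-- can pass to `f ∘ suc`.
length-filter-tabulate : {P : A → Set} (P? : ∀ x → Dec (P x)) (f : Fin n → A) →
  length (filter P? (tabulate f)) ≡ count (does ∘ P? ∘ f)
length-filter-tabulate {n = zero}  P? f = refl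
length-filter-tabulate {n = suc n} P? f with does (P? (f zero))
... | true  = cong suc (length-filter-tabulate P? (f ∘ suc))
... | false = length-filter-tabulate P? (f ∘ suc)

count-pos⁺ : (P : Fin n → Bool) (i : Fin n) → P i ≡ true → 0 < count P
count-pos⁺ {suc n} P i Pi rewrite sum-remove {i = i} (⟦_⟧ ∘ P) | Pi = z<s

count-pos⁻ : (P : Fin n → Bool) → 0 < count P → ∃ λ i → P i ≡ true
count-pos⁻ {suc n} P pos with P zero in eq
... | true  = zero , eq
... | false = let i , Pi = count-pos⁻ (P ∘ suc) pos in suc i , Pi

sum-const : ∀ n x → ∑[ i < n ] x ≡ n * x
sum-const zero    x = refl
sum-const (suc n) x = cong (x +_) (sum-const n x)

count-singleton : (a : Fin n) (P : Fin n → Bool) → count (λ b → does (b ≟ a) ∧ P b) ≡ ⟦ P a ⟧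
count-singleton {suc n} zero    P = trans (cong (⟦ P zero ⟧ +_) (sum-replicate-zero n)) (+-identityʳ _)
count-singleton {suc n} (suc a) P = count-singleton a (P ∘ suc)

sum-↑ : ∀ m (f : Fin (m + n) → ℕ) → sum f ≡ sum (f ∘ (_↑ˡ n)) + sum (f ∘ (m ↑ʳ_))
sum-↑ zero    f = refl
sum-↑ (suc m) f = trans (cong (f zero +_) (sum-↑ m (f ∘ suc))) (sym (+-assoc (f zero) _ _))

sum-combine : ∀ n₁ n₂ (f : Fin (n₁ * n₂) → ℕ) → sum f ≡ ∑[ x < n₁ ] ∑[ a < n₂ ] f (combine x a)
sum-combine zero     n₂ f = refl
sum-combine (suc n₁) n₂ f = trans (sum-↑ n₂ f) (cong (sum (λ a → f (a ↑ˡ (n₁ * n₂))) +_) (sum-combine n₁ n₂ (f ∘ (n₂ ↑ʳ_))))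

-- Families with equal value multiplicities are rearrangements of each other.
sum-matching : (_≟ᴬ_ : DecidableEquality A) (u v : Fin n → A) →
  (∀ a → count (λ i → does (u i ≟ᴬ a)) ≡ count (λ i → does (v i ≟ᴬ a))) →
  (f g : Fin n → ℕ) → (∀ i j → u i ≡ v j → f i ≡ g j) → sum f ≡ sum g
sum-matching {n = zero}  _≟ᴬ_ u v same f g f≈g = refl
sum-matching {n = suc n} _≟ᴬ_ u v same f g f≈g = begin
  f zero + sum (f ∘ suc)  ≡⟨ cong₂ _+_ (f≈g zero j (sym vj≡u0)) rest ⟩
  g j + sum (removeAt g j) ≡⟨ sum-remove g ⟨
  sum g ∎
  where
  open ≡-Reasoning
  found : ∃ λ j → does (v j ≟ᴬ u zero) ≡ true
  found = count-pos⁻ _ (subst (0 <_) (same (u zero)) (count-pos⁺ (λ i → does (u i ≟ᴬ u zero)) zero (dec-true (u zero ≟ᴬ u zero) refl)))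
  j : Fin (suc n)
  j = proj₁ found
  vj≡u0 : v j ≡ u zero
  vj≡u0 = from-does (v j ≟ᴬ u zero) (proj₂ found)
  rest : sum (f ∘ suc) ≡ sum (removeAt g j)
  rest = sum-matching _≟ᴬ_ (u ∘ suc) (removeAt v j)
    (λ a → +-cancelˡ-≡ ⟦ does (u zero ≟ᴬ a) ⟧ _ _ (begin
      count (λ i → does (u i ≟ᴬ a))
        ≡⟨ same a ⟩
      count (λ i → does (v i ≟ᴬ a))
        ≡⟨ sum-remove {i = j} (λ i → ⟦ does (v i ≟ᴬ a) ⟧) ⟩
      ⟦ does (v j ≟ᴬ a) ⟧ + count (λ i → does (removeAt v j i ≟ᴬ a))
        ≡⟨ cong (λ w → ⟦ does (w ≟ᴬ a) ⟧ + count (λ i → does (removeAt v j i ≟ᴬ a))) vj≡u0 ⟩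
      ⟦ does (u zero ≟ᴬ a) ⟧ + count (λ i → does (removeAt v j i ≟ᴬ a)) ∎))
    (f ∘ suc) (removeAt g j) (λ i i′ → f≈g (suc i) (punchIn j i′))

-- Coherent configurations

module Colours (Z : CoherentConfiguration n) where
  open CoherentConfiguration Z using (diagonal; converse; coherent)

  private
    c : Fin n → Fin n → Fin (rank Z)
    c = colour Z

  -- The diagonal is a union of colour classes, so the colour of a loop occurs on loops only.
  loop : ∀ {α β γ} → c α α ≡ c β γ → β ≡ γ
  loop eq = let I , to , from = diagonal in from (subst (_∈ I) eq (to refl))

  flipped : ∀ {α β α′ β′} → c α β ≡ c α′ β′ → c β α ≡ c β′ α′
  flipped {α} {β} {α′} {β′} eq =
    let s* , to , from = converse (c α β) in trans (from refl) (sym (from (sym eq)))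

  private
    -- The two colours are packed into one pair, the value whose multiplicities `sum-matching`
    -- compares.
    paths-count : ∀ s t α β →
      CoherentConfiguration.paths Z s t α β ≡
      count (λ γ → does (×-≡-dec _≟_ _≟_ (c α γ , c γ β) (s , t)))
    paths-count s t α β = trans
      (length-filter-tabulate (λ γ → (c α γ ≟ s) ×-dec (c γ β ≟ t)) id)
      (sum-cong-≗ λ γ → cong ⟦_⟧ (does-⇔ (mk⇔ (uncurry (cong₂ _,_)) ,-injective)
        ((c α γ ≟ s) ×-dec (c γ β ≟ t)) (×-≡-dec _≟_ _≟_ (c α γ , c γ β) (s , t))))

    same-paths : ∀ {α β α′ β′} → c α β ≡ c α′ β′ → ∀ st →
      count (λ γ → does (×-≡-dec _≟_ _≟_ (c α γ , c γ β) st)) ≡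
      count (λ γ → does (×-≡-dec _≟_ _≟_ (c α′ γ , c γ β′) st))
    same-paths {α} {β} {α′} {β′} eq (s , t) = trans (sym (paths-count s t α β))
      (trans (coherent s t (c α β) refl (sym eq)) (paths-count s t α′ β′))

  -- The point `γ` shows that an intersection number is positive at `(α , β)`; by coherence it is
  -- positive at `(α′ , β′)` too.
  transport : ∀ {α β α′ β′} → c α β ≡ c α′ β′ → ∀ γ →
    ∃ λ γ′ → c α γ ≡ c α′ γ′ × c γ β ≡ c γ′ β′
  transport {α} {β} eq γ =
    let st = c α γ , c γ β
        γ′ , found = count-pos⁻ _ (subst (0 <_) (same-paths eq st)
                       (count-pos⁺ _ γ (dec-true (×-≡-dec _≟_ _≟_ st st) refl)))
        p , q = ,-injective (from-does (×-≡-dec _≟_ _≟_ _ st) found)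
    in γ′ , sym p , sym q

  -- Coherence in the form used for every count below: a sum over `γ` of a quantity determined by
  -- the colours of `(α , γ)` and `(γ , β)` depends only on the colour of `(α , β)`.
  sum-invariant : ∀ {α β α′ β′} → c α β ≡ c α′ β′ → (f g : Fin n → ℕ) →
    (∀ γ γ′ → c α γ ≡ c α′ γ′ → c γ β ≡ c γ′ β′ → f γ ≡ g γ′) → sum f ≡ sum g
  sum-invariant eq f g f≈g = sum-matching (×-≡-dec _≟_ _≟_) _ _ (same-paths eq) f g
    λ γ γ′ → uncurry (f≈g γ γ′) ∘ ,-injective

  -- The path from `α` through `α` to `β` is transported, and `loop` forces its new middle point to
  -- be `α′`.
  source : ∀ {α β α′ β′} → c α β ≡ c α′ β′ → c α α ≡ c α′ α′
  source {α} {α′ = α′} eq with γ′ , p , _ ← transport eq α =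
    trans p (cong (c α′) (sym (loop p)))

  target : ∀ {α β α′ β′} → c α β ≡ c α′ β′ → c β β ≡ c β′ β′
  target = source ∘ flipped

-- The form of `X ≤ᶠ Z` in terms of colours; the next lemmas prove the two equivalent.
Refines : CoherentConfiguration n → CoherentConfiguration n → Set
Refines X Z = ∀ {α β α′ β′} → colour Z α β ≡ colour Z α′ β′ → colour X α β ≡ colour X α′ β′

relation-invariant : (Z : CoherentConfiguration n) {R : Fin n → Fin n → Set} → IsRelation Z R →
  ∀ {α β α′ β′} → colour Z α β ≡ colour Z α′ β′ → R α β → R α′ β′
relation-invariant Z (I , to , from) eq r = from (subst (_∈ I) eq (to r))

≤ᶠ⇒refines : (X Z : CoherentConfiguration n) → X ≤ᶠ Z → Refines X Z
≤ᶠ⇒refines X Z X≤Z {α} {β} eq = sym (relation-invariant Z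
  (X≤Z (basic X s) (⁅ s ⁆ , (λ eq′ → subst (_∈ ⁅ s ⁆) (sym eq′) (x∈⁅x⁆ s)) , x∈⁅y⁆⇒x≡y s)) eq refl)
  where s = colour X α β

∈-tabulate⁺ : (P : Fin n → Bool) {i : Fin n} → P i ≡ true → i ∈ tabulateᵛ P
∈-tabulate⁺ P {i} Pi = lookup⇒[]= i _ (trans (lookup∘tabulate P i) Pi)

∈-tabulate⁻ : (P : Fin n → Bool) {i : Fin n} → i ∈ tabulateᵛ P → P i ≡ true
∈-tabulate⁻ P {i} i∈ = trans (sym (lookup∘tabulate P i)) ([]=⇒lookup i∈)

refines⇒≤ᶠ : (X Z : CoherentConfiguration n) → Refines X Z → X ≤ᶠ Z
refines⇒≤ᶠ X Z ref R (I , to , from) = tabulateᵛ J ,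
  (λ {α} {β} r → ∈-tabulate⁺ J (trans (J-colour α β) ([]=⇒lookup (to r)))) ,
  (λ {α} {β} c∈ → from (lookup⇒[]= _ I (trans (sym (J-colour α β)) (∈-tabulate⁻ J c∈))))
  where
  open CoherentConfiguration Z using (nonempty)
  -- A colour of `Z` is sorted by the `X`-colour of one representative pair; refinement makes the
  -- choice of the pair immaterial.
  J : Fin (rank Z) → Bool
  J t = let α , β , _ = nonempty t in lookup I (colour X α β)
  J-colour : ∀ α β → J (colour Z α β) ≡ lookup I (colour X α β)
  J-colour α β = let _ , _ , eq = nonempty (colour Z α β) in cong (lookup I) (ref eq)

-- Loops of equal colour belong to the same fiber, so this describes the unions of fibers without
-- listing fibers.
Closed : CoherentConfiguration n → Subset n → Set
Closed Z Γ = ∀ {α β} → colour Z α α ≡ colour Z β β → lookup Γ α ≡ lookup Γ β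

∈-⋃⁻ : ∀ (Φs : List (Subset n)) {α} → α ∈ ⋃ Φs → ∃ λ Φ → Φ List.∈ Φs × α ∈ Φ
∈-⋃⁻ []       α∈ = contradiction α∈ ∉⊥
∈-⋃⁻ (Φ ∷ Φs) α∈ with x∈p∪q⁻ Φ (⋃ Φs) α∈
... | inj₁ α∈Φ = Φ , here refl , α∈Φ
... | inj₂ α∈⋃ = let Φ′ , Φ′∈ , α∈Φ′ = ∈-⋃⁻ Φs α∈⋃ in Φ′ , there Φ′∈ , α∈Φ′

∈-⋃⁺ : ∀ {Φs : List (Subset n)} {Φ α} → Φ List.∈ Φs → α ∈ Φ → α ∈ ⋃ Φs
∈-⋃⁺ (here refl) α∈Φ = x∈p∪q⁺ (inj₁ α∈Φ)
∈-⋃⁺ (there Φ∈)  α∈Φ = x∈p∪q⁺ (inj₂ (∈-⋃⁺ Φ∈ α∈Φ))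

true-⇔ : ∀ {a b} → (a ≡ true → b ≡ true) → (b ≡ true → a ≡ true) → a ≡ b
true-⇔ {true}          f g = sym (f refl)
true-⇔ {false} {true}  f g = g refl
true-⇔ {false} {false} f g = refl

unionOfFibers⇒closed : (Z : CoherentConfiguration n) {Γ : Subset n} → IsUnionOfFibers Z Γ → Closed Z Γ
unionOfFibers⇒closed Z {Γ} (Φs , fibers , refl) eq = true-⇔ (go eq) (go (sym eq))
  where
  go : ∀ {α β} → colour Z α α ≡ colour Z β β → lookup Γ α ≡ true → lookup Γ β ≡ true
  go {α} {β} eq α∈Γ with Φ , Φ∈ , α∈Φ ← ∈-⋃⁻ Φs (lookup⇒[]= α Γ α∈Γ)
                    with s , to , from ← All.lookup fibers Φ∈ =
    []=⇒lookup (∈-⋃⁺ Φ∈ (proj₂ (to (trans (sym eq) (from (refl , α∈Φ))))))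

-- The list holds the fiber of each point of `Γ`; its repetitions do not affect the union.
closed⇒unionOfFibers : (Z : CoherentConfiguration n) {Γ : Subset n} → Closed Z Γ → IsUnionOfFibers Z Γ
closed⇒unionOfFibers {n} Z {Γ} closed = map fiber points ,
  All.tabulate (λ Φ∈ → let α , _ , Φ≡ = ∈-map⁻ fiber Φ∈ in subst (IsFiber Z) (sym Φ≡) (isFiber α)) ,
  ⊆-antisym ⋃⊆Γ Γ⊆⋃
  where
  inFiber : Fin n → Fin n → Bool
  inFiber α β = does (colour Z β β ≟ colour Z α α)
  fiber : Fin n → Subset n
  fiber α = tabulateᵛ (inFiber α)
  points : List (Fin n)
  points = filter (_∈? Γ) (allFin n)
  isFiber : ∀ α → IsFiber Z (fiber α)
  isFiber α = colour Z α α ,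
    (λ {β} {γ} eq → let β≡γ = Colours.loop Z (sym eq) in
      β≡γ , ∈-tabulate⁺ (inFiber α) (dec-true (_ ≟ _) (trans (cong (colour Z β) β≡γ) eq))) ,
    λ { (refl , β∈) → from-does (_ ≟ _) (∈-tabulate⁻ (inFiber α) β∈) }
  ⋃⊆Γ : ∀ {α} → α ∈ ⋃ (map fiber points) → α ∈ Γ
  ⋃⊆Γ {α} α∈ with Φ , Φ∈ , α∈Φ ← ∈-⋃⁻ (map fiber points) α∈
             with β , β∈ , refl ← ∈-map⁻ fiber Φ∈ =
    lookup⇒[]= α Γ (trans (closed (from-does (_ ≟ _) (∈-tabulate⁻ (inFiber β) α∈Φ)))
                          ([]=⇒lookup (proj₂ (∈-filter⁻ (_∈? Γ) {xs = allFin n} β∈))))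
  Γ⊆⋃ : ∀ {α} → α ∈ Γ → α ∈ ⋃ (map fiber points)
  Γ⊆⋃ {α} α∈ = ∈-⋃⁺ (∈-map⁺ fiber (∈-filter⁺ (_∈? Γ) (∈-allFin α) α∈))
                    (∈-tabulate⁺ (inFiber α) (dec-true (colour Z α α ≟ _) refl))

-- Colourings as configurations

-- Numbers the values of `f` without gaps, as the field `nonempty` of a configuration demands. The
-- first entry shares the number of a later entry of equal value, or else gets a new one.
compress : DecidableEquality A → (f : Fin m → A) →
  ∃ λ r → Σ (Fin m → Fin r) λ g →
    (∀ t → ∃ λ i → g i ≡ t) × (∀ i j → g i ≡ g j → f i ≡ f j) × (∀ i j → f i ≡ f j → g i ≡ g j)
compress {m = zero}  _≟ᴬ_ f = zero , (λ ()) , (λ ()) , (λ ()) , (λ ())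
compress {m = suc m} _≟ᴬ_ f
  with r , g , onto , reflects , respects ← compress _≟ᴬ_ (f ∘ suc)
     | any? (λ i → f zero ≟ᴬ f (suc i))
... | yes (i₀ , eq₀) = r , g′ ,
      (λ t → let i , eq = onto t in suc i , eq) , reflects′ , respects′
  where
  g′ : Fin (suc m) → Fin r
  g′ zero    = g i₀
  g′ (suc i) = g i
  reflects′ : ∀ i j → g′ i ≡ g′ j → f i ≡ f j
  reflects′ zero    zero    eq = refl
  reflects′ zero    (suc j) eq = trans eq₀ (reflects i₀ j eq)
  reflects′ (suc i) zero    eq = trans (reflects i i₀ eq) (sym eq₀)
  reflects′ (suc i) (suc j) eq = reflects i j eq
  respects′ : ∀ i j → f i ≡ f j → g′ i ≡ g′ j
  respects′ zero    zero    eq = refl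
  respects′ zero    (suc j) eq = respects i₀ j (trans (sym eq₀) eq)
  respects′ (suc i) zero    eq = respects i i₀ (trans eq eq₀)
  respects′ (suc i) (suc j) eq = respects i j eq
... | no new = suc r , g′ , onto′ , reflects′ , respects′
  where
  g′ : Fin (suc m) → Fin (suc r)
  g′ zero    = zero
  g′ (suc i) = suc (g i)
  onto′ : ∀ t → ∃ λ i → g′ i ≡ t
  onto′ zero    = zero , refl
  onto′ (suc t) = let i , eq = onto t in suc i , cong suc eq
  reflects′ : ∀ i j → g′ i ≡ g′ j → f i ≡ f j
  reflects′ zero    zero    eq = refl
  reflects′ (suc i) (suc j) eq = reflects i j (suc-injective eq)
  respects′ : ∀ i j → f i ≡ f j → g′ i ≡ g′ j
  respects′ zero    zero    eq = refl
  respects′ zero    (suc j) eq = contradiction (j , eq) new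
  respects′ (suc i) zero    eq = contradiction (i , sym eq) new
  respects′ (suc i) (suc j) eq = cong suc (respects i j eq)

-- A coherent configuration with colours in any type with decidable equality, where some colours may
-- not occur. Restrictions to blocks and quotients arise in this form.
record CoherentColouring (n : ℕ) (A : Set) : Set where
  field
    _≟ᴬ_     : DecidableEquality A
    c        : Fin n → Fin n → A
    loop     : ∀ {α β γ} → c α α ≡ c β γ → β ≡ γ
    flipped  : ∀ {α β α′ β′} → c α β ≡ c α′ β′ → c β α ≡ c β′ α′
    coherent : ∀ {α β α′ β′} → c α β ≡ c α′ β′ → ∀ s t →
      count (λ γ → does (c α γ ≟ᴬ s) ∧ does (c γ β ≟ᴬ t)) ≡
      count (λ γ → does (c α′ γ ≟ᴬ s) ∧ does (c γ β′ ≟ᴬ t))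

  private
    compressed = compress _≟ᴬ_ (uncurry c ∘ remQuot {n} n)
    r = proj₁ compressed
    g = proj₁ (proj₂ compressed)
    onto = proj₁ (proj₂ (proj₂ compressed))

    d : Fin n → Fin n → Fin r
    d α β = g (combine α β)

    c-combine : ∀ α β → uncurry c (remQuot {n} n (combine α β)) ≡ c α β
    c-combine α β = cong (uncurry c) (remQuot-combine α β)

    reflects : ∀ {α β α′ β′} → d α β ≡ d α′ β′ → c α β ≡ c α′ β′
    reflects {α} {β} {α′} {β′} eq = trans (sym (c-combine α β))
      (trans (proj₁ (proj₂ (proj₂ (proj₂ compressed))) _ _ eq) (c-combine α′ β′))

    respects : ∀ {α β α′ β′} → c α β ≡ c α′ β′ → d α β ≡ d α′ β′
    respects {α} {β} {α′} {β′} eq = proj₂ (proj₂ (proj₂ (proj₂ compressed))) _ _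
      (trans (c-combine α β) (trans eq (sym (c-combine α′ β′))))

    nonempty : ∀ t → ∃₂ λ α β → d α β ≡ t
    nonempty t = let i , eq = onto t ; α , β = remQuot {n} n i in
      α , β , trans (cong g (combine-remQuot {n} n i)) eq

    isLoop : Fin r → Bool
    isLoop t = let α , β , _ = nonempty t in does (α ≟ β)

    d-paths : ∀ σ σ′ τ τ′ α β →
      length (filter (λ γ → (d α γ ≟ d σ σ′) ×-dec (d γ β ≟ d τ τ′)) (allFin n)) ≡
      count (λ γ → does (c α γ ≟ᴬ c σ σ′) ∧ does (c γ β ≟ᴬ c τ τ′))
    d-paths σ σ′ τ τ′ α β = trans (length-filter-tabulate (λ γ → (d α γ ≟ d σ σ′) ×-dec (d γ β ≟ d τ τ′)) id)
      (sum-cong-≗ λ γ → cong₂ (λ x y → ⟦ x ∧ y ⟧)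
        (does-⇔ (mk⇔ reflects respects) (d α γ ≟ d σ σ′) (c α γ ≟ᴬ c σ σ′))
        (does-⇔ (mk⇔ reflects respects) (d γ β ≟ d τ τ′) (c γ β ≟ᴬ c τ τ′)))

  configuration : CoherentConfiguration n
  configuration = record
    { rank     = r
    ; colour   = d
    ; nonempty = nonempty
    ; diagonal = tabulateᵛ isLoop , diagonal⇒ , diagonal⇐
    ; converse = λ s → let α , β , eq = nonempty s in d β α ,
        (λ eq′ → trans (respects (flipped (reflects eq′))) eq) ,
        (λ eq′ → respects (flipped (reflects (trans eq′ (sym eq)))))
    ; coherent = λ s t u {α} {β} {α′} {β′} eq eq′ → paths-coherent s t α β α′ β′ (trans eq (sym eq′))
    }
    where
    diagonal⇒ : ∀ {α β} → α ≡ β → d α β ∈ tabulateᵛ isLoop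
    diagonal⇒ {α} refl = let β , γ , eq = nonempty (d α α) in
      ∈-tabulate⁺ isLoop (dec-true (β ≟ γ) (loop (reflects (sym eq))))
    diagonal⇐ : ∀ {α β} → d α β ∈ tabulateᵛ isLoop → α ≡ β
    diagonal⇐ {α} {β} c∈ = let σ , σ′ , eq = nonempty (d α β) ; σ≡σ′ = from-does (σ ≟ σ′) (∈-tabulate⁻ isLoop c∈) in
      loop (reflects (trans (cong (d σ) σ≡σ′) eq))
    paths-coherent : ∀ s t α β α′ β′ → d α β ≡ d α′ β′ →
      length (filter (λ γ → (d α γ ≟ s) ×-dec (d γ β ≟ t)) (allFin n)) ≡
      length (filter (λ γ → (d α′ γ ≟ s) ×-dec (d γ β′ ≟ t)) (allFin n))
    -- Each new colour is named by a pair that carries it; the value of `c` at that pair is the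
    -- matching old colour.
    paths-coherent s t α β α′ β′ eq with σ , σ′ , refl ← nonempty s | τ , τ′ , refl ← nonempty t =
      trans (d-paths σ σ′ τ τ′ α β) (trans (coherent (reflects eq) _ _) (sym (d-paths σ σ′ τ τ′ α′ β′)))

  colour⇒ : ∀ {α β α′ β′} → colour configuration α β ≡ colour configuration α′ β′ → c α β ≡ c α′ β′
  colour⇒ = reflects

  colour⇐ : ∀ {α β α′ β′} → c α β ≡ c α′ β′ → colour configuration α β ≡ colour configuration α′ β′
  colour⇐ = respects

discreteColouring : ∀ n → CoherentColouring n (Fin (n * n))
discreteColouring n = record
  { _≟ᴬ_     = _≟_
  ; c        = combine
  ; loop     = λ {α} {β} {γ} eq → let p , q = combine-injective α α β γ eq in trans (sym p) q
  ; flipped  = λ {α} {β} {α′} {β′} eq → let p , q = combine-injective α β α′ β′ eq in cong₂ combine q p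
  ; coherent = λ {α} {β} {α′} {β′} eq s t → let p , q = combine-injective α β α′ β′ eq in
      cong₂ (λ x y → count (λ γ → does (combine x γ ≟ s) ∧ does (combine γ y ≟ t))) p q
  }

discrete : ∀ n → CoherentConfiguration n
discrete n = CoherentColouring.configuration (discreteColouring n)

discrete-injective : ∀ {α β α′ β′ : Fin n} →
  colour (discrete n) α β ≡ colour (discrete n) α′ β′ → α ≡ α′ × β ≡ β′
discrete-injective {n} {α} {β} {α′} {β′} eq = combine-injective α β α′ β′
  (CoherentColouring.colour⇒ (discreteColouring n) eq)

-- Generalized bases

-- By minimality `Z` refines the `Π`-fission, whose basic relations are singletons.
base⇒complete : (X : CoherentConfiguration n) {Π : List (Subset n)} → IsGeneralizedBase X Π →
  ∀ Z → Refines X Z → (∀ {Γ} → Γ List.∈ Π → Closed Z Γ) →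
  ∀ {α β} → colour Z α α ≡ colour Z β β → α ≡ β
base⇒complete X (_ , Y , setFission , complete) Z ref closed eq =
  proj₁ (complete _ refl (sym (≤ᶠ⇒refines Y Z
    (smallest Z (refines⇒≤ᶠ X Z ref) (All.tabulate (closed⇒unionOfFibers Z ∘ λ Γ∈ → closed Γ∈))) eq)))
  where open IsSetFission setFission

-- Separating points is enough: the colour of a pair determines the fibers of both ends, hence the
-- pair. So every such `Z` refines the discrete configuration, which is therefore the `Π`-fission.
complete⇒base : (X : CoherentConfiguration n) {Π : List (Subset n)} → Unique Π →
  (∀ Z → Refines X Z → (∀ {Γ} → Γ List.∈ Π → Closed Z Γ) →
    ∀ {α β} → colour Z α α ≡ colour Z β β → α ≡ β) →
  IsGeneralizedBase X Π
complete⇒base {n} X {Π} unique complete = unique , discrete n ,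
  record
    { fission  = refines⇒≤ᶠ X (discrete n) (refined X)
    ; unions   = All.tabulate (λ {Γ} _ → closed⇒unionOfFibers (discrete n)
                   (λ eq → cong (lookup Γ) (proj₁ (discrete-injective eq))))
    ; smallest = λ Z X≤Z unions → refines⇒≤ᶠ (discrete n) Z λ eq →
        let complete′ = complete Z (≤ᶠ⇒refines X Z X≤Z) (λ Γ∈ → unionOfFibers⇒closed Z (All.lookup unions Γ∈))
        in cong₂ (colour (discrete n)) (complete′ (Colours.source Z eq)) (complete′ (Colours.target Z eq))
    } ,
  λ s eq eq′ → discrete-injective (trans eq (sym eq′))
  where
  refined : ∀ X → Refines X (discrete n)
  refined X eq = let p , q = discrete-injective eq in cong₂ (colour X) p q

-- Antisymmetric configurations

module OddFiber (X : CoherentConfiguration n) (antisymmetric : Antisymmetric X) (x₀ : Fin n) where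
  open Colours X

  inFiber : Fin n → Bool
  inFiber x = does (colour X x x ≟ colour X x₀ x₀)

  inFiber-invariant : ∀ {x y} → colour X x x ≡ colour X y y → inFiber x ≡ inFiber y
  inFiber-invariant = cong (λ s → does (s ≟ colour X x₀ x₀))

  private
    c : Fin n → Fin n → Fin (rank X)
    c = colour X

    -- The tournament: two distinct points of the fiber are joined in the direction in which the
    -- number of the colour is smaller.
    out into : Fin n → Fin n → Bool
    out  x y = inFiber y ∧ does (c x y <? c y x)
    into x y = inFiber y ∧ does (c y x <? c x y)

    -- One pair with equal colours in both directions makes its whole basic relation symmetric.
    symmetric⇒≡ : ∀ {x y} → c x y ≡ c y x → x ≡ y
    symmetric⇒≡ {x} {y} eq = antisymmetric (c x y)
      ((λ eq′ → trans (flipped eq′) (sym eq)) , (λ eq′ → trans (flipped eq′) (sym eq))) refl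

    trichotomy : ∀ x y → inFiber x ≡ true →
      ⟦ inFiber y ⟧ ≡ ⟦ does (y ≟ x) ∧ true ⟧ + (⟦ out x y ⟧ + ⟦ into x y ⟧)
    trichotomy x y x∈F with y ≟ x
    ... | yes refl rewrite x∈F | dec-false (c x x <? c x x) (<-irrefl refl) = refl
    ... | no y≢x with inFiber y
    ... | false = refl
    ... | true with <-cmp (c x y) (c y x)
    ... | tri< p _ q rewrite dec-true (c x y <? c y x) p | dec-false (c y x <? c x y) q = refl
    ... | tri≈ _ p _ = contradiction (sym (symmetric⇒≡ p)) y≢x
    ... | tri> q _ p rewrite dec-true (c y x <? c x y) p | dec-false (c x y <? c y x) q = refl

    outdegree indegree : ℕ
    outdegree = count (out x₀)
    indegree  = count (into x₀)

    -- Regularity: the degree of `x` depends only on the colour of the loop at `x`, so it is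
    -- constant on the fiber.
    weighted : (d : Fin n → Fin n → Bool) →
      (∀ {x x′ y y′} → c x y ≡ c x′ y′ → c y x ≡ c y′ x′ → d x y ≡ d x′ y′) →
      ∑[ x < n ] (⟦ inFiber x ⟧ * count (d x)) ≡ count inFiber * count (d x₀)
    weighted d inv = trans (sum-cong-≗ pointwise) (sym (*-distribʳ-sum (count (d x₀)) (⟦_⟧ ∘ inFiber)))
      where
      pointwise : ∀ x → ⟦ inFiber x ⟧ * count (d x) ≡ ⟦ inFiber x ⟧ * count (d x₀)
      pointwise x with colour X x x ≟ colour X x₀ x₀
      ... | no  _  = refl
      ... | yes eq = cong (1 *_) (sum-invariant eq _ _ (λ γ γ′ p q → cong ⟦_⟧ (inv p q)))

    swap : ∀ x y → ⟦ inFiber x ⟧ * ⟦ out x y ⟧ ≡ ⟦ inFiber y ⟧ * ⟦ into y x ⟧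
    swap x y with inFiber x | inFiber y
    ... | true  | true  = refl
    ... | true  | false = refl
    ... | false | true  = refl
    ... | false | false = refl

    -- The edges of the tournament are counted by their tails and by their heads.
    double : count inFiber * outdegree ≡ count inFiber * indegree
    double = begin
      count inFiber * outdegree
        ≡⟨ weighted out (λ p q → cong₂ _∧_ (inFiber-invariant (target p)) (cong₂ (λ s t → does (s <? t)) p q)) ⟨
      ∑[ x < n ] (⟦ inFiber x ⟧ * count (out x))
        ≡⟨ sum-cong-≗ (λ x → *-distribˡ-sum ⟦ inFiber x ⟧ (⟦_⟧ ∘ out x)) ⟩
      ∑[ x < n ] ∑[ y < n ] (⟦ inFiber x ⟧ * ⟦ out x y ⟧)
        ≡⟨ ∑-comm (λ x y → ⟦ inFiber x ⟧ * ⟦ out x y ⟧) ⟩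
      ∑[ y < n ] ∑[ x < n ] (⟦ inFiber x ⟧ * ⟦ out x y ⟧)
        ≡⟨ sum-cong-≗ (λ y → sum-cong-≗ (λ x → swap x y)) ⟩
      ∑[ y < n ] ∑[ x < n ] (⟦ inFiber y ⟧ * ⟦ into y x ⟧)
        ≡⟨ sum-cong-≗ (λ y → *-distribˡ-sum ⟦ inFiber y ⟧ (⟦_⟧ ∘ into y)) ⟨
      ∑[ y < n ] (⟦ inFiber y ⟧ * count (into y))
        ≡⟨ weighted into (λ p q → cong₂ _∧_ (inFiber-invariant (target p)) (cong₂ (λ s t → does (s <? t)) q p)) ⟩
      count inFiber * indegree ∎
      where open ≡-Reasoning

  x₀∈fiber : inFiber x₀ ≡ true
  x₀∈fiber = dec-true (c x₀ x₀ ≟ c x₀ x₀) refl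

  -- The fiber consists of `x₀`, its out-neighbours and its in-neighbours; dividing `double` by the
  -- size of the fiber shows that the last two sets have equal size.
  odd-fiber : ∃ λ d → count inFiber ≡ suc (d + d)
  odd-fiber = outdegree , (begin
    count inFiber
      ≡⟨ sum-cong-≗ (λ y → trichotomy x₀ y x₀∈fiber) ⟩
    ∑[ y < n ] (⟦ does (y ≟ x₀) ∧ true ⟧ + (⟦ out x₀ y ⟧ + ⟦ into x₀ y ⟧))
      ≡⟨ ∑-distrib-+ (λ y → ⟦ does (y ≟ x₀) ∧ true ⟧) _ ⟩
    count (λ y → does (y ≟ x₀) ∧ true) + ∑[ y < n ] (⟦ out x₀ y ⟧ + ⟦ into x₀ y ⟧)
      ≡⟨ cong₂ _+_ (count-singleton x₀ (λ _ → true)) (∑-distrib-+ (⟦_⟧ ∘ out x₀) (⟦_⟧ ∘ into x₀)) ⟩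
    1 + (outdegree + indegree)
      ≡⟨ cong (λ d → suc (outdegree + d)) (sym (*-cancelˡ-≡ _ _ (count inFiber) {{>-nonZero (count-pos⁺ inFiber x₀ x₀∈fiber)}} double)) ⟩
    suc (outdegree + outdegree) ∎)
    where open ≡-Reasoning

-- Adding `F` to `Γ` changes the size by the size of `F` minus twice that of the intersection, an
-- odd number.
count-xor≢ : (F Γ : Fin n → Bool) → (∃ λ d → count F ≡ suc (d + d)) →
  count (λ x → Γ x xor F x) ≢ count Γ
count-xor≢ {n} F Γ (d , odd) eq = even≢odd both d (begin
  2 * both            ≡⟨ cong (both +_) (+-identityʳ both) ⟩
  both + both         ≡⟨ +-cancelˡ-≡ (count Γ) _ _ inclusion-exclusion ⟩
  count F             ≡⟨ odd ⟩
  suc (d + d)         ≡⟨ cong (λ k → suc (d + k)) (+-identityʳ d) ⟨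
  suc (2 * d)         ∎)
  where
  open ≡-Reasoning
  both : ℕ
  both = count (λ x → Γ x ∧ F x)
  pointwise : ∀ g f → ⟦ g xor f ⟧ + (⟦ g ∧ f ⟧ + ⟦ g ∧ f ⟧) ≡ ⟦ g ⟧ + ⟦ f ⟧
  pointwise true  true  = refl
  pointwise true  false = refl
  pointwise false true  = refl
  pointwise false false = refl
  inclusion-exclusion : count Γ + (both + both) ≡ count Γ + count F
  inclusion-exclusion = begin
    count Γ + (both + both)
      ≡⟨ cong₂ _+_ eq (∑-distrib-+ (λ x → ⟦ Γ x ∧ F x ⟧) (λ x → ⟦ Γ x ∧ F x ⟧)) ⟨
    count (λ x → Γ x xor F x) + ∑[ x < n ] (⟦ Γ x ∧ F x ⟧ + ⟦ Γ x ∧ F x ⟧)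
      ≡⟨ ∑-distrib-+ (λ x → ⟦ Γ x xor F x ⟧) _ ⟨
    ∑[ x < n ] (⟦ Γ x xor F x ⟧ + (⟦ Γ x ∧ F x ⟧ + ⟦ Γ x ∧ F x ⟧))
      ≡⟨ sum-cong-≗ (λ x → pointwise (Γ x) (F x)) ⟩
    ∑[ x < n ] (⟦ Γ x ⟧ + ⟦ F x ⟧)
      ≡⟨ ∑-distrib-+ (⟦_⟧ ∘ Γ) (⟦_⟧ ∘ F) ⟩
    count Γ + count F ∎

-- Blocks and quotients

second-combine : (x : Fin n₁) (a : Fin n₂) → second n₁ n₂ (combine x a) ≡ a
second-combine x a = cong proj₂ (remQuot-combine x a)

count-block : ∀ n₁ n₂ (a : Fin n₂) (P : Fin (n₁ * n₂) → Bool) →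
  count (λ γ → does (second n₁ n₂ γ ≟ a) ∧ P γ) ≡ count (λ (x : Fin n₁) → P (combine x a))
count-block n₁ n₂ a P = trans (sum-combine n₁ n₂ _) (sum-cong-≗ λ (x : Fin n₁) → trans
  (sum-cong-≗ λ b → cong (λ b′ → ⟦ does (b′ ≟ a) ∧ P (combine x b) ⟧) (second-combine x b))
  (count-singleton a (λ b → P (combine x b))))

sum-second : ∀ n₁ n₂ (h : Fin n₂ → ℕ) → sum (h ∘ second n₁ n₂) ≡ n₁ * sum h
sum-second n₁ n₂ h = trans (sum-combine n₁ n₂ (h ∘ second n₁ n₂))
  (trans (sum-cong-≗ λ (x : Fin n₁) → sum-cong-≗ λ a → cong h (second-combine x a)) (sum-const n₁ (sum h)))

_≟ˢ_ : DecidableEquality (Subset n)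
_≟ˢ_ = Vec-≡-dec Bool._≟_

module Blocks (n₁ n₂ : ℕ) (Z : CoherentConfiguration (n₁ * n₂))
  (sameBlock : ∀ {α β α′ β′} → colour Z α β ≡ colour Z α′ β′ →
    SameBlock n₁ n₂ α β → SameBlock n₁ n₂ α′ β′) where
  open Colours Z

  private
    sec : Fin (n₁ * n₂) → Fin n₂
    sec = second n₁ n₂
    c : Fin (n₁ * n₂) → Fin (n₁ * n₂) → Fin (rank Z)
    c = colour Z

  ∈block-invariant : ∀ {α α′ γ γ′ a a′} → sec α ≡ a → sec α′ ≡ a′ → c α γ ≡ c α′ γ′ →
    does (sec γ ≟ a) ≡ does (sec γ′ ≟ a′)
  ∈block-invariant refl refl eq = does-⇔
    (mk⇔ (sym ∘ sameBlock eq ∘ sym) (sym ∘ sameBlock (sym eq) ∘ sym)) (_ ≟ _) (_ ≟ _)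

  blockColouring : Fin n₂ → CoherentColouring n₁ (Fin (rank Z))
  blockColouring a = record
    { _≟ᴬ_     = _≟_
    ; c        = λ x y → c (combine x a) (combine y a)
    ; loop     = λ {_} {y} {z} eq → proj₁ (combine-injective y a z a (loop eq))
    ; flipped  = flipped
    -- The count over the block becomes a count over all `γ` with the extra condition of lying in
    -- the block, which the colour of `(combine x a , γ)` decides.
    ; coherent = λ {x} {y} {x′} {y′} eq s t → trans
        (sym (count-block n₁ n₂ a (λ γ → does (c (combine x a) γ ≟ s) ∧ does (c γ (combine y a) ≟ t))))
        (trans (sum-invariant eq _ _ λ γ γ′ p q → cong ⟦_⟧ (cong₂ _∧_
                 (∈block-invariant (second-combine x a) (second-combine x′ a) p)
                 (cong₂ (λ u v → does (u ≟ s) ∧ does (v ≟ t)) p q)))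
               (count-block n₁ n₂ a (λ γ → does (c (combine x′ a) γ ≟ s) ∧ does (c γ (combine y′ a) ≟ t))))
    }

  blockConfiguration : Fin n₂ → CoherentConfiguration n₁
  blockConfiguration a = CoherentColouring.configuration (blockColouring a)

  occurs? : ∀ a b s → Dec (∃₂ λ α β → sec α ≡ a × sec β ≡ b × c α β ≡ s)
  occurs? a b s = any? λ α → any? λ β → (sec α ≟ a) ×-dec (sec β ≟ b) ×-dec (c α β ≟ s)

  -- Distinct sets of this form are disjoint, so they can serve as the colours of the quotient.
  occurring : Fin n₂ → Fin n₂ → Subset (rank Z)
  occurring a b = tabulateᵛ (λ s → does (occurs? a b s))

  occurring⁺ : ∀ α β → c α β ∈ occurring (sec α) (sec β)
  occurring⁺ α β = ∈-tabulate⁺ (λ s → does (occurs? _ _ s)) (dec-true (occurs? _ _ _) (α , β , refl , refl , refl))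

  occurring⁻ : ∀ {a b s} → s ∈ occurring a b → ∃₂ λ α β → sec α ≡ a × sec β ≡ b × c α β ≡ s
  occurring⁻ {a} {b} {s} s∈ = from-does (occurs? a b s) (∈-tabulate⁻ (λ s → does (occurs? a b s)) s∈)

  -- For `u` and `v` in the blocks of `α` and `β`, first `u` is transported along the path to `β`,
  -- then `v` along the path from `u` to `β`. The images lie in the blocks of `α′` and `β′`, and the
  -- colour of `(u , v)` is kept.
  occurring-invariant : ∀ {α β α′ β′} → c α β ≡ c α′ β′ →
    occurring (sec α) (sec β) ≡ occurring (sec α′) (sec β′)
  occurring-invariant eq = ⊆-antisym (go eq) (go (sym eq))
    where
    go : ∀ {α β α′ β′} → c α β ≡ c α′ β′ →
      ∀ {s} → s ∈ occurring (sec α) (sec β) → s ∈ occurring (sec α′) (sec β′)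
    go {α′ = α′} {β′} eq s∈ with u , v , u~α , v~β , refl ← occurring⁻ s∈
             with u′ , αu , uβ ← transport eq u
             with v′ , uv , vβ ← transport uβ v =
      subst (_∈ occurring (sec α′) (sec β′)) (sym uv) (subst (c u′ v′ ∈_)
        (cong₂ occurring (sym (sameBlock αu (sym u~α))) (sameBlock vβ v~β)) (occurring⁺ u′ v′))

  -- The way back from quotient colours to colours of `Z`, for any chosen representatives of the
  -- first two blocks.
  occurring-match : ∀ {a b a′ b′} → occurring a b ≡ occurring a′ b′ → ∀ {α β} → sec α ≡ a → sec β ≡ b →
    ∃₂ λ α′ β′ → sec α′ ≡ a′ × sec β′ ≡ b′ × c α β ≡ c α′ β′
  occurring-match eq {α} {β} refl refl =
    let α′ , β′ , p , q , r = occurring⁻ (subst (c α β ∈_) eq (occurring⁺ α β)) in α′ , β′ , p , q , sym r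

  -- The point `x₀` gives a representative `combine x₀ a` of every block; if the blocks were empty,
  -- all quotient colours would coincide.
  module Quotient (x₀ : Fin n₁) where

    quotientColouring : CoherentColouring n₂ (Subset (rank Z))
    quotientColouring = record
      { _≟ᴬ_     = _≟ˢ_
      ; c        = occurring
      ; loop     = quotient-loop
      ; flipped  = quotient-flipped
      ; coherent = quotient-coherent
      }
      where
      quotient-loop : ∀ {a b d} → occurring a a ≡ occurring b d → b ≡ d
      quotient-loop {a} eq with β , γ , refl , refl , eq′ ← occurring-match eq (second-combine x₀ a) (second-combine x₀ a) =
        cong sec (loop eq′)
      quotient-flipped : ∀ {a b a′ b′} → occurring a b ≡ occurring a′ b′ → occurring b a ≡ occurring b′ a′
      quotient-flipped {a} {b} eq
        with α′ , β′ , refl , refl , eq′ ← occurring-match eq (second-combine x₀ a) (second-combine x₀ b) =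
        trans (cong₂ occurring (sym (second-combine x₀ b)) (sym (second-combine x₀ a)))
              (occurring-invariant (flipped eq′))
      quotient-coherent : ∀ {a b a′ b′} → occurring a b ≡ occurring a′ b′ → ∀ s t →
        count (λ d → does (occurring a d ≟ˢ s) ∧ does (occurring d b ≟ˢ t)) ≡
        count (λ d → does (occurring a′ d ≟ˢ s) ∧ does (occurring d b′ ≟ˢ t))
      quotient-coherent {a} {b} eq s t
        with α′ , β′ , refl , refl , eq′ ← occurring-match eq (second-combine x₀ a) (second-combine x₀ b) =
        -- Multiplied by `n₁`, a count of blocks `d` becomes a count of points `γ`, to which the
        -- coherence of `Z` applies.
        *-cancelˡ-≡ _ _ n₁ {{nonZeroIndex x₀}} (trans (sym (sum-second n₁ n₂ _))
          (trans (sum-invariant eq′ _ _ λ γ γ′ p q → cong₂ (λ u v → ⟦ does (u ≟ˢ s) ∧ does (v ≟ˢ t) ⟧)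
                   (trans (cong (λ a → occurring a (sec γ)) (sym (second-combine x₀ a))) (occurring-invariant p))
                   (trans (cong (occurring (sec γ)) (sym (second-combine x₀ b))) (occurring-invariant q)))
                 (sum-second n₁ n₂ _)))

    quotientConfiguration : CoherentConfiguration n₂
    quotientConfiguration = CoherentColouring.configuration quotientColouring

-- The wreath conditions in terms of colours

∈block⁺ : ∀ {α : Fin (n₁ * n₂)} {a} → second n₁ n₂ α ≡ a → α ∈ block n₁ n₂ a
∈block⁺ {n₁} {n₂} {α} {a} eq = ∈-tabulate⁺ (λ α → does (second n₁ n₂ α ≟ a)) (dec-true (_ ≟ _) eq)

∈block⁻ : ∀ {α : Fin (n₁ * n₂)} {a} → α ∈ block n₁ n₂ a → second n₁ n₂ α ≡ a
∈block⁻ {n₁} {n₂} {α} {a} α∈ = from-does (_ ≟ _) (∈-tabulate⁻ (λ α → does (second n₁ n₂ α ≟ a)) α∈)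

module _ (X₁ : CoherentConfiguration n₁) (X₂ : CoherentConfiguration n₂)
         (X : CoherentConfiguration (n₁ * n₂)) (conditions : WreathConditions X₁ X₂ X) where
  open WreathConditions conditions

  -- The trace of a basic relation of `X` on a block is the image of a single basic relation of
  -- `X₁`.
  restriction-refines : ∀ {a x y x′ y′} →
    colour X (combine x a) (combine y a) ≡ colour X (combine x′ a) (combine y′ a) →
    colour X₁ x y ≡ colour X₁ x′ y′
  restriction-refines {a} {x} {y} {x′} {y′} eq = trans (image-colour refl) (sym (image-colour (sym eq)))
    where
    s = colour X (combine x a) (combine y a)
    R : Fin (n₁ * n₂) → Fin (n₁ * n₂) → Set
    R α β = basic X s α β × α ∈ block n₁ n₂ a × β ∈ block n₁ n₂ a
    point : ∀ x → combine x a ∈ block n₁ n₂ a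
    point x = ∈block⁺ {n₁} (second-combine x a)
    isImage : image (λ x → combine x a) X₁ R
    isImage = proj₁ (restrictions a) ((s , id , id) , combine x a , combine y a , refl , point x , point y)
    image-colour : ∀ {x y} → basic X s (combine x a) (combine y a) → colour X₁ x y ≡ proj₁ isImage
    image-colour {x} {y} eq
      with u , v , p , q , eq′ ← proj₁ (proj₂ isImage) (eq , point x , point y)
      with refl , _ ← combine-injective u a x a p | refl , _ ← combine-injective v a y a q = eq′

  -- A basic relation of `X` induces on the blocks the image of a single basic relation of `X₂`. The
  -- point of `Fin n₁` makes the blocks nonempty, so that distinct indices give distinct blocks.
  quotient-refines : Fin n₁ → ∀ {α β α′ β′} → colour X α β ≡ colour X α′ β′ →
    colour X₂ (second n₁ n₂ α) (second n₁ n₂ β) ≡ colour X₂ (second n₁ n₂ α′) (second n₁ n₂ β′)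
  quotient-refines x₀ {α} {β} eq = trans (image-colour refl) (sym (image-colour (sym eq)))
    where
    s = colour X α β
    R : Subset (n₁ * n₂) → Subset (n₁ * n₂) → Set
    R Γ Δ = IsClassOf (SameBlock n₁ n₂) Γ × IsClassOf (SameBlock n₁ n₂) Δ ×
            ∃₂ λ α β → α ∈ Γ × β ∈ Δ × basic X s α β
    isImage : image (block n₁ n₂) X₂ R
    isImage = proj₁ quotients (s , id , id)
    isClass : ∀ α → IsClassOf (SameBlock n₁ n₂) (block n₁ n₂ (second n₁ n₂ α))
    isClass α = α , λ β → (λ β∈ → sym (∈block⁻ {n₁} β∈)) , (λ eq → ∈block⁺ {n₁} (sym eq))
    block-injective : ∀ {a b} → block n₁ n₂ a ≡ block n₁ n₂ b → a ≡ b
    block-injective {a} eq = trans (sym (second-combine x₀ a))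
      (∈block⁻ {n₁} (subst (combine x₀ a ∈_) eq (∈block⁺ {n₁} (second-combine x₀ a))))
    image-colour : ∀ {α β} → basic X s α β → colour X₂ (second n₁ n₂ α) (second n₁ n₂ β) ≡ proj₁ isImage
    image-colour {α} {β} eq
      with u , v , p , q , eq′ ← proj₁ (proj₂ isImage)
             (isClass α , isClass β , α , β , ∈block⁺ {n₁} refl , ∈block⁺ {n₁} refl , eq)
      with refl ← block-injective p | refl ← block-injective q = eq′

-- Lists

unique-⊆⇒length≤ : {xs ys : List A} → Unique xs → (∀ {x} → x List.∈ xs → x List.∈ ys) → length xs ≤ length ys
unique-⊆⇒length≤ []                 xs⊆ys = z≤n
unique-⊆⇒length≤ {xs = x ∷ xs} (x∉xs ∷ unique) xs⊆ys
  with ys₁ , ys₂ , refl ← ∈-∃++ (xs⊆ys (here refl)) =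
  ≤-trans (s≤s (unique-⊆⇒length≤ unique xs⊆ys₁₂)) (≤-reflexive (sym (length-++-sucʳ ys₁ x ys₂)))
  where
  xs⊆ys₁₂ : ∀ {y} → y List.∈ xs → y List.∈ ys₁ ++ ys₂
  xs⊆ys₁₂ y∈xs with ∈-++⁻ ys₁ (xs⊆ys (there y∈xs))
  ... | inj₁ y∈ys₁         = ∈-++⁺ˡ y∈ys₁
  ... | inj₂ (here refl)   = contradiction refl (All.lookup x∉xs y∈xs)
  ... | inj₂ (there y∈ys₂) = ∈-++⁺ʳ ys₁ y∈ys₂

module _ (_≟ᴬ_ : DecidableEquality A) where
  open DecMembership _≟ᴬ_ using () renaming (_∈?_ to _∈ᴸ?_)

  -- The pigeonhole principle: otherwise all of `xs` would fit into the shorter list `ys`.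
  fresh : {xs : List A} → Unique xs → ∀ ys → length ys < length xs → ∃ λ x → ¬ (x List.∈ ys)
  fresh {xs} unique ys ys<xs with Any.any? (λ x → ¬? (x ∈ᴸ? ys)) xs
  ... | yes some = Any.satisfied some
  ... | no  none = contradiction
    (unique-⊆⇒length≤ unique λ {x} x∈xs → decidable-stable (x ∈ᴸ? ys) (λ x∉ys → none (List.lose x∈xs x∉ys)))
    (<⇒≱ ys<xs)

  -- Repetitions in ys are replaced by fresh elements.
  unique-superset : {xs : List A} → Unique xs → ∀ ys → length ys ≤ length xs →
    ∃ λ zs → Unique zs × length zs ≡ length ys × (∀ {y} → y List.∈ ys → y List.∈ zs)
  unique-superset unique []       _     = [] , [] , refl , λ ()
  unique-superset {xs} unique (y ∷ ys) ys<xs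
    with zs , unique-zs , len , ys⊆zs ← unique-superset unique ys (≤-trans (n≤1+n _) ys<xs)
    with y ∈ᴸ? zs
  ... | no  y∉zs = y ∷ zs , All.tabulate (λ z∈ y≡z → y∉zs (subst (List._∈ zs) (sym y≡z) z∈)) ∷ unique-zs ,
    cong suc len , λ { (here eq) → here eq ; (there y∈) → there (ys⊆zs y∈) }
  ... | yes y∈zs with w , w∉zs ← fresh unique zs (subst (_< length xs) (sym len) ys<xs) =
    w ∷ zs , All.tabulate (λ z∈ w≡z → w∉zs (subst (List._∈ zs) (sym w≡z) z∈)) ∷ unique-zs ,
    cong suc len , λ { (here refl) → there y∈zs ; (there y∈) → there (ys⊆zs y∈) }

module _ (f : A → B → C) (x₀ : A) (y₀ : B) where

  -- Both lists are used up, so the length is the maximum of the two lengths; this is the source of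
  -- the maximum in the bound.
  zipPadded : List A → List B → List C
  zipPadded = alignWith (foldWithDefaults x₀ y₀ f)

  ∈-zipPaddedˡ : ∀ {x} xs ys → x List.∈ xs → ∃ λ y → f x y List.∈ zipPadded xs ys
  ∈-zipPaddedˡ (x ∷ xs) []       x∈          = y₀ , ∈-map⁺ _ x∈
  ∈-zipPaddedˡ (x ∷ xs) (y ∷ ys) (here refl) = y , here refl
  ∈-zipPaddedˡ (x ∷ xs) (y ∷ ys) (there x∈)  = let y′ , fxy∈ = ∈-zipPaddedˡ xs ys x∈ in y′ , there fxy∈

  ∈-zipPaddedʳ : ∀ {y} xs ys → y List.∈ ys → ∃ λ x → f x y List.∈ zipPadded xs ys
  ∈-zipPaddedʳ []       (y ∷ ys) y∈          = x₀ , ∈-map⁺ _ y∈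
  ∈-zipPaddedʳ (x ∷ xs) (y ∷ ys) (here refl) = x , here refl
  ∈-zipPaddedʳ (x ∷ xs) (y ∷ ys) (there y∈)  = let x′ , fxy∈ = ∈-zipPaddedʳ xs ys y∈ in x′ , there fxy∈

pullback : (Fin m → Fin n) → Subset n → Subset m
pullback f Γ = tabulateᵛ (lookup Γ ∘ f)

pullback-injective : (f : Fin m → Fin n) (g : Fin n → Fin m) → (∀ x → f (g x) ≡ x) →
  ∀ {Γ Δ} → pullback f Γ ≡ pullback f Δ → Γ ≡ Δ
pullback-injective f g f∘g {Γ} {Δ} eq = trans (sym (section Γ)) (trans (cong (pullback g) eq) (section Δ))
  where
  section : ∀ Γ → pullback g (pullback f Γ) ≡ Γ
  section Γ = trans
    (tabulate-cong (λ x → trans (lookup∘tabulate (lookup Γ ∘ f) (g x)) (cong (lookup Γ) (f∘g x))))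
    (tabulate∘lookup Γ)

-- Bases of wreath products

module Wreath {n₁ n₂ : ℕ} (X₁ : CoherentConfiguration n₁) (X₂ : CoherentConfiguration n₂)
              (X : CoherentConfiguration (n₁ * n₂)) (conditions : WreathConditions X₁ X₂ X)
              (antisymmetric : Antisymmetric X₁) (x₀ : Fin n₁) where
  open OddFiber X₁ antisymmetric x₀

  private
    sec : Fin (n₁ * n₂) → Fin n₂
    sec = second n₁ n₂
    fst : Fin (n₁ * n₂) → Fin n₁
    fst = proj₁ ∘ remQuot n₂

  -- The set Λ(Γ , Δ), as a predicate on pairs; F is the fiber of x₀.
  twistᵇ : Subset n₁ → Subset n₂ → Fin n₁ → Fin n₂ → Bool
  twistᵇ Γ Δ x a = lookup Γ x xor (inFiber x ∧ not (lookup Δ a))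

  twist : Subset n₁ → Subset n₂ → Subset (n₁ * n₂)
  twist Γ Δ = tabulateᵛ (uncurry (twistᵇ Γ Δ) ∘ remQuot n₂)

  lookup-twist : ∀ Γ Δ x a → lookup (twist Γ Δ) (combine x a) ≡ twistᵇ Γ Δ x a
  lookup-twist Γ Δ x a = trans (lookup∘tabulate (uncurry (twistᵇ Γ Δ) ∘ remQuot n₂) (combine x a))
    (cong (uncurry (twistᵇ Γ Δ)) (remQuot-combine x a))

  -- The trace has the size of `Γ` inside `Δ` and of `Γ + F` outside, and these differ in parity.
  block-size-reflects : ∀ Γ Δ {a b} →
    count (λ x → twistᵇ Γ Δ x a) ≡ count (λ x → twistᵇ Γ Δ x b) → lookup Δ a ≡ lookup Δ b
  block-size-reflects Γ Δ {a} {b} eq = go (lookup Δ a) (lookup Δ b) eq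
    where
    size : Bool → ℕ
    size δ = count (λ x → lookup Γ x xor (inFiber x ∧ not δ))
    inside≢outside : size false ≢ size true
    inside≢outside eq = count-xor≢ inFiber (lookup Γ) odd-fiber (trans
      (sum-cong-≗ λ x → cong (λ f → ⟦ lookup Γ x xor f ⟧) (sym (∧-identityʳ (inFiber x))))
      (trans eq (sum-cong-≗ λ x → cong ⟦_⟧
        (trans (cong (lookup Γ x xor_) (∧-zeroʳ (inFiber x))) (xor-identityʳ (lookup Γ x))))))
    go : ∀ δ ε → size δ ≡ size ε → δ ≡ ε
    go true  true  _  = refl
    go true  false eq = contradiction (sym eq) inside≢outside
    go false true  eq = contradiction eq inside≢outside
    go false false _  = refl

  module _ (Z : CoherentConfiguration (n₁ * n₂)) (refines : Refines X Z) where
    open Colours Z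
    open Blocks n₁ n₂ Z (λ eq → relation-invariant X (WreathConditions.isRelation conditions) (refines eq))
    open Quotient x₀

    block-refines : ∀ a → Refines X₁ (blockConfiguration a)
    block-refines a eq = restriction-refines X₁ X₂ X conditions
      (refines (CoherentColouring.colour⇒ (blockColouring a) eq))

    quotientConfiguration-refines : Refines X₂ quotientConfiguration
    quotientConfiguration-refines {a} {b} eq
      with α′ , β′ , refl , refl , eq′ ← occurring-match (CoherentColouring.colour⇒ quotientColouring eq)
                                           (second-combine x₀ a) (second-combine x₀ b) =
      trans (cong₂ (colour X₂) (sym (second-combine x₀ a)) (sym (second-combine x₀ b)))
            (quotient-refines X₁ X₂ X conditions x₀ (refines eq′))

    module _ (Γ : Subset n₁) (Δ : Subset n₂) (closed : Closed Z (twist Γ Δ)) where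

      -- The trace on the block is `Γ` or `Γ + F`. As the block configuration refines `X₁`, the set
      -- `F` is a union of its fibers and can be cancelled.
      block-closed : ∀ a → Closed (blockConfiguration a) Γ
      block-closed a {x} {y} eq = xor-cancelʳ (lookup Γ x) (lookup Γ y)
        (cong (_∧ not (lookup Δ a)) (inFiber-invariant (block-refines a eq)))
        (trans (sym (lookup-twist Γ Δ x a)) (trans
          (closed (CoherentColouring.colour⇒ (blockColouring a) eq)) (lookup-twist Γ Δ y a)))
        where
        xor-cancelʳ : ∀ g h {f f′} → f ≡ f′ → g xor f ≡ h xor f′ → g ≡ h
        xor-cancelʳ true  true          refl _  = refl
        xor-cancelʳ true  false {true}  refl ()
        xor-cancelʳ true  false {false} refl ()
        xor-cancelʳ false true  {true}  refl ()
        xor-cancelʳ false true  {false} refl ()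
        xor-cancelʳ false false         refl _  = refl

      -- Blocks whose quotient loops have equal colours contain points whose loops have equal
      -- colours in `Z`, so the twist meets these blocks in equally many points.
      quotient-closed : Closed quotientConfiguration Δ
      quotient-closed {a} {b} eq
        with α′ , β′ , sα′ , _ , eq′ ← occurring-match (CoherentColouring.colour⇒ quotientColouring eq)
                                           (second-combine x₀ a) (second-combine x₀ a) =
        block-size-reflects Γ Δ (trans (sym (size a)) (trans
          (sum-invariant eq′ _ _ λ γ γ′ p q → cong ⟦_⟧ (cong₂ _∧_
            (∈block-invariant (second-combine x₀ a) sα′ p) (closed (target p))))
          (size b)))
        where
        size : ∀ a → count (λ γ → does (sec γ ≟ a) ∧ lookup (twist Γ Δ) γ) ≡ count (λ x → twistᵇ Γ Δ x a)
        size a = trans (count-block n₁ n₂ a (lookup (twist Γ Δ)))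
          (sum-cong-≗ λ x → cong ⟦_⟧ (lookup-twist Γ Δ x a))

  -- The condition under which `Γ̃` can replace the member `Γ` of a generalized base of `X₁`.
  Determines : Subset n₁ → Subset n₁ → Set
  Determines Γ̃ Γ = ∀ Z → Refines X₁ Z → Closed Z Γ̃ → Closed Z Γ

  twists-complete : {Π₁ : List (Subset n₁)} {Π₂ : List (Subset n₂)} {Π : List (Subset (n₁ * n₂))} →
    IsGeneralizedBase X₁ Π₁ → IsGeneralizedBase X₂ Π₂ →
    (∀ {Γ} → Γ List.∈ Π₁ → ∃₂ λ Γ̃ Δ → Determines Γ̃ Γ × twist Γ̃ Δ List.∈ Π) →
    (∀ {Δ} → Δ List.∈ Π₂ → ∃ λ Γ → twist Γ Δ List.∈ Π) →
    ∀ Z → Refines X Z → (∀ {Λ} → Λ List.∈ Π → Closed Z Λ) →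
    ∀ {α β} → colour Z α α ≡ colour Z β β → α ≡ β
  twists-complete base₁ base₂ twists₁ twists₂ Z refines closed {α} {β} eq =
    same (fst α) (fst β) (sec α) (sec β) (combine-remQuot {n₁} n₂ α) (combine-remQuot {n₁} n₂ β) sameSecond
    where
    open Blocks n₁ n₂ Z (λ eq → relation-invariant X (WreathConditions.isRelation conditions) (refines eq))
    open Quotient x₀
    sameSecond : sec α ≡ sec β
    sameSecond = base⇒complete X₂ base₂ quotientConfiguration (quotientConfiguration-refines Z refines)
      (λ {Δ} Δ∈ → let Γ , Λ∈ = twists₂ Δ∈ in quotient-closed Z refines Γ Δ (closed Λ∈))
      (CoherentColouring.colour⇐ quotientColouring (occurring-invariant eq))
    -- The coordinates are made variables so that the equality of the blocks can be matched; what
    -- remains takes place in one block.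
    same : ∀ x y a b → combine x a ≡ α → combine y b ≡ β → a ≡ b → α ≡ β
    same x y a .a refl refl refl = cong (λ x → combine x a)
      (base⇒complete X₁ base₁ (blockConfiguration a) (block-refines Z refines a)
        (λ {Γ} Γ∈ → let Γ̃ , Δ , determines , Λ∈ = twists₁ Γ∈ in
          determines (blockConfiguration a) (block-refines Z refines a) (block-closed Z refines Γ̃ Δ (closed Λ∈) a))
        (CoherentColouring.colour⇐ (blockColouring a) eq))

  -- Proper twists

  avoids? : ∀ Γ → Dec ((∃ λ x → lookup Γ x ≡ false) × (∃ λ x → lookup Γ x xor inFiber x ≡ false))
  avoids? Γ = any? (λ x → lookup Γ x Bool.≟ false) ×-dec any? (λ x → (lookup Γ x xor inFiber x) Bool.≟ false)

  -- The traces of a twist are `Γ` and `Γ + F`; `avoids?` tests that neither of them is the whole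
  -- point set.
  amend : Subset n₁ → Subset n₁
  amend Γ = if does (avoids? Γ) then Γ else ⁅ x₀ ⁆

  -- A set that is replaced is everything or the complement of `F`, hence a union of fibers in every
  -- fission of `X₁`.
  amend-determines : ∀ Γ → Determines (amend Γ) Γ
  amend-determines Γ Z refines closed {α} {β} eq with any? (λ x → lookup Γ x Bool.≟ false)
                                         | any? (λ x → (lookup Γ x xor inFiber x) Bool.≟ false)
  ... | yes _ | yes _    = closed eq
  ... | no full | _      = trans (¬-not (full ∘ (α ,_))) (sym (¬-not (full ∘ (β ,_))))
  ... | yes _ | no cofib = trans (complement α)
    (trans (cong not (inFiber-invariant (refines eq))) (sym (complement β)))
    where
    complement : ∀ x → lookup Γ x ≡ not (inFiber x)
    complement x with lookup Γ x | inFiber x | ¬-not (cofib ∘ (x ,_))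
    ... | true  | false | _ = refl
    ... | false | true  | _ = refl

  other : 1 < n₁ → ∃ λ x → x ≢ x₀
  other 1<n₁ = go 1<n₁ x₀
    where
    go : ∀ {n} → 1 < n → (x₀ : Fin n) → ∃ λ x → x ≢ x₀
    go (s≤s (s≤s _)) zero    = suc zero , λ ()
    go (s≤s (s≤s _)) (suc _) = zero , λ ()

  -- With `F` added the point `x₀` drops out, since it lies in `F`; otherwise a second point of the
  -- block is missed.
  singleton-avoids : 1 < n₁ → ∀ δ → ∃ λ x → lookup ⁅ x₀ ⁆ x xor (inFiber x ∧ δ) ≡ false
  singleton-avoids 1<n₁ true  = x₀ , cong₂ (λ g f → g xor (f ∧ true)) ([]=⇒lookup (x∈⁅x⁆ x₀)) x₀∈fiber
  singleton-avoids 1<n₁ false = let x , x≢x₀ = other 1<n₁ in x ,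
    trans (cong (lookup ⁅ x₀ ⁆ x xor_) (∧-zeroʳ (inFiber x))) (trans (xor-identityʳ _)
      (¬-not (λ x∈ → x≢x₀ (x∈⁅y⁆⇒x≡y x₀ (lookup⇒[]= x ⁅ x₀ ⁆ x∈)))))

  amend-avoids : 1 < n₁ → ∀ Γ δ → ∃ λ x → lookup (amend Γ) x xor (inFiber x ∧ δ) ≡ false
  amend-avoids 1<n₁ Γ δ with any? (λ x → lookup Γ x Bool.≟ false)
                           | any? (λ x → (lookup Γ x xor inFiber x) Bool.≟ false) | δ
  ... | no _         | _            | δ′    = singleton-avoids 1<n₁ δ′
  ... | yes _        | no _         | δ′    = singleton-avoids 1<n₁ δ′
  ... | yes (x , eq) | yes _        | false = x ,
    trans (cong (lookup Γ x xor_) (∧-zeroʳ (inFiber x))) (trans (xor-identityʳ _) eq)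
  ... | yes _        | yes (x , eq) | true  = x , trans (cong (lookup Γ x xor_) (∧-identityʳ _)) eq

  twist-proper : 1 < n₁ → ∀ Γ Δ a → let Λ = twist (amend Γ) Δ in
    (∀ {α} → α ∈ Λ ∩ block n₁ n₂ a → α ∈ block n₁ n₂ a) ×
    ∃ λ α → α ∈ block n₁ n₂ a × α ∉ Λ ∩ block n₁ n₂ a
  twist-proper 1<n₁ Γ Δ a = p∩q⊆q Λ (block n₁ n₂ a) , combine x a , ∈block⁺ {n₁} (second-combine x a) ,
    λ α∈ → contradiction (trans (sym ([]=⇒lookup (p∩q⊆p Λ (block n₁ n₂ a) α∈)))
                                (trans (lookup-twist (amend Γ) Δ x a) outside)) λ ()
    where
    Λ = twist (amend Γ) Δ
    x = proj₁ (amend-avoids 1<n₁ Γ (not (lookup Δ a)))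
    outside = proj₂ (amend-avoids 1<n₁ Γ (not (lookup Δ a)))

  wreath-base : Fin n₂ → {Π₁ : List (Subset n₁)} {Π₂ : List (Subset n₂)} →
    IsGeneralizedBase X₁ Π₁ → IsGeneralizedBase X₂ Π₂ →
    ∃ λ Π → IsGeneralizedBase X Π × length Π ≡ length Π₁ ⊔ length Π₂ ×
      (0 < length Π₁ ⊔ length Π₂ → 1 < n₁ → IsProper n₁ n₂ Π)
  wreath-base a₀ {Π₁} {Π₂} base₁ base₂ = Π ,
    complete⇒base X unique (twists-complete base₁ base₂ twists₁ twists₂) ,
    trans length-Π length-twists , proper
    where
    twists : List (Subset (n₁ * n₂))
    -- The padding `⊤` is arbitrary: a member of one base may be paired with any set on the other
    -- side.
    twists = zipPadded (twist ∘ amend) ⊤ ⊤ Π₁ Π₂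
    length-twists : length twists ≡ length Π₁ ⊔ length Π₂
    length-twists = length-alignWith Π₁ Π₂
    -- A supply of enough distinct sets, found by pulling back the longer base; `a₀` or `x₀`
    -- provides a section of the projection.
    many : ∃ λ Ψ → Unique Ψ × length Ψ ≡ length Π₁ ⊔ length Π₂
    many with ⊔-sel (length Π₁) (length Π₂)
    ... | inj₁ eq = map (pullback fst) Π₁ ,
      map⁺ (pullback-injective fst (λ x → combine x a₀) (λ x → cong proj₁ (remQuot-combine x a₀))) (proj₁ base₁) ,
      trans (length-map _ Π₁) (sym eq)
    ... | inj₂ eq = map (pullback sec) Π₂ ,
      map⁺ (pullback-injective sec (combine x₀) (second-combine x₀)) (proj₁ base₂) ,
      trans (length-map _ Π₂) (sym eq)
    -- Twists may repeat, for instance when `amend` identifies members of `Π₁`. Exchanging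
    -- repetitions for other sets restores the exact size, and extra sets only refine the fission.
    extended = unique-superset _≟ˢ_ (proj₁ (proj₂ many)) twists
      (≤-reflexive (trans length-twists (sym (proj₂ (proj₂ many)))))
    Π = proj₁ extended
    unique = proj₁ (proj₂ extended)
    length-Π = proj₁ (proj₂ (proj₂ extended))
    twists⊆Π : ∀ {Λ} → Λ List.∈ twists → Λ List.∈ Π
    twists⊆Π = proj₂ (proj₂ (proj₂ extended))
    twists₁ : ∀ {Γ} → Γ List.∈ Π₁ → ∃₂ λ Γ̃ Δ → Determines Γ̃ Γ × twist Γ̃ Δ List.∈ Π
    twists₁ {Γ} Γ∈ = let Δ , Λ∈ = ∈-zipPaddedˡ (twist ∘ amend) ⊤ ⊤ Π₁ Π₂ Γ∈ in
      amend Γ , Δ , amend-determines Γ , twists⊆Π Λ∈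
    twists₂ : ∀ {Δ} → Δ List.∈ Π₂ → ∃ λ Γ → twist Γ Δ List.∈ Π
    twists₂ Δ∈ = let Γ , Λ∈ = ∈-zipPaddedʳ (twist ∘ amend) ⊤ ⊤ Π₁ Π₂ Δ∈ in amend Γ , twists⊆Π Λ∈
    some-twist : ∀ Π₁ Π₂ → 0 < length Π₁ ⊔ length Π₂ →
      ∃₂ λ Γ Δ → twist (amend Γ) Δ List.∈ zipPadded (twist ∘ amend) ⊤ ⊤ Π₁ Π₂
    some-twist (Γ ∷ Π₁) Π₂ _ = Γ , ∈-zipPaddedˡ (twist ∘ amend) ⊤ ⊤ (Γ ∷ Π₁) Π₂ (here refl)
    some-twist [] (Δ ∷ Π₂) _ = ⊤ , Δ , here refl
    proper : 0 < length Π₁ ⊔ length Π₂ → 1 < n₁ → IsProper n₁ n₂ Π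
    proper 0<b 1<n₁ = let Γ , Δ , Λ∈ = some-twist Π₁ Π₂ 0<b in
      List.lose (twists⊆Π Λ∈) (twist-proper 1<n₁ Γ Δ)

-- The empty cases and the theorem

empty-base : (X : CoherentConfiguration n) → ¬ Fin n → IsGeneralizedBase X []
empty-base X empty = complete⇒base X [] λ Z _ _ {α} _ → contradiction α empty

-- Properness is claimed for `1 < n₁`: when blocks are single points, a set with proper trace on
-- every block is empty and separates nothing.
theorem5p2 : ∀ {n₁ n₂ : ℕ} (X₁ : CoherentConfiguration n₁) (X₂ : CoherentConfiguration n₂)
    (X : CoherentConfiguration (n₁ * n₂)) → IsWreathProduct X₁ X₂ X →
    ∀ (b₁ b₂ : ℕ) → IsGb X₁ b₁ → IsGb X₂ b₂ →
    Antisymmetric X₁ →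
    (∀ (g : ℕ) → IsGb X g → g ≤ b₁ ⊔ b₂)
    × (0 < b₁ ⊔ b₂ → 1 < n₁ → 0 < n₂ →
    ∃ λ Π → IsGeneralizedBase X Π × IsProper n₁ n₂ Π × length Π ≡ b₁ ⊔ b₂)
-- If either factor has no points, there is no `x₀` or no `a₀` to build twists with; the product is
-- then empty as well, and the empty list is a base.
theorem5p2 {zero} X₁ X₂ X _ _ _ _ _ _ =
  (λ g (_ , least) → ≤-trans (least [] (empty-base X λ ())) z≤n) , λ _ ()
theorem5p2 {suc n₁} {zero} X₁ X₂ X _ _ _ _ _ _ =
  (λ g (_ , least) → ≤-trans (least [] (empty-base X λ α → contradiction (second (suc n₁) zero α) λ ())) z≤n) ,
  λ _ _ ()
theorem5p2 {suc n₁} {suc n₂} X₁ X₂ X wreath _ _ ((Π₁ , base₁ , refl) , _) ((Π₂ , base₂ , refl) , _) antisymmetric =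
  (λ g (_ , least) → subst (g ≤_) length-Π (least Π base)) ,
  λ 0<b 1<n₁ _ → Π , base , proper 0<b 1<n₁ , length-Π
  where
  wreathBase = Wreath.wreath-base X₁ X₂ X (IsWreathProduct.conditions wreath) antisymmetric zero zero base₁ base₂
  Π = proj₁ wreathBase
  base = proj₁ (proj₂ wreathBase)
  length-Π = proj₁ (proj₂ (proj₂ wreathBase))
  proper = proj₂ (proj₂ (proj₂ wreathBase))
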